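{- Let $n\ge 3$. In the Game of Cycles on the $C_n$ board (a cycle graph with $n$ vertices and $n$ edges embedded in the plane, with its single bounded cell), the outcome is determined by the parity of $n$ regardless of how the players play: if $n$ is odd, Player~1 wins, and if $n$ is even, Player~2 wins.
   Context: The Game of Cycles. A board is a simple connected planar graph embedded in the plane, together with its bounded cells. Two players alternate turns; on a turn a player marks one unmarked edge with an arrow pointing along the edge in one of its two directions. Each edge receives at most one arrow, and arrows have the same effect regardless of who placed them. Moves must obey the sink-source rule: no move may create a sink (a vertex all of whose incident edges are marked with arrows pointing toward it) or a source (a vertex all of whose incident edges are marked with arrows pointing away from it). A player who has a legal move must make one. A cycle cell is a bounded cell all of whose boundary edges are marked with arrows all cycling in the same direction around that cell. The first player to create a cycle cell wins; if play ends (no legal move remains) without a cycle cell, the player who made the last move wins. -}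

module Defs where

open import Data.Nat using (ℕ; suc)
open import Data.Nat.DivMod using (_mod_)
open import Data.Fin using (Fin; toℕ)
open import Data.Fin.Properties using (nonZeroIndex)
open import Data.List using (List; []; _∷_; map; allFin)
open import Data.List.Relation.Unary.All using (All)
open import Data.List.Relation.Unary.Any using (Any)
open import Data.Maybe using (Maybe; just; nothing)
open import Data.Product using (_×_; _,_; ∃)
open import Data.Sum using (_⊎_)
open import Data.Vec using (Vec; replicate; lookup; _[_]≔_)
open import Function using (_∘_)
open import Relation.Binary.PropositionalEquality using (_≡_)
open import Relation.Nullary using (¬_)

data Direction : Set where
  forward backward : Direction

opposite : Direction → Direction
opposite forward  = backward
opposite backward = forward

-- The data of an embedded planar graph to which the rules of the game refer.
-- Each edge has two endpoints, listed in an arbitrary order that only serves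
-- to name its two directions: `forward` is from `end₁` to `end₂`.  The
-- embedding enters the rules only through the bounded cells; each is given by
-- its boundary, traversed once around the cell, as a list of edges together
-- with the direction in which the traversal runs along them.  Simplicity,
-- connectedness and planarity are not imposed, as no rule refers to them.
record Board : Set where
  field
    #vertices : ℕ
    #edges    : ℕ
    end₁ end₂ : Fin #edges → Fin #vertices
    cells     : List (List (Fin #edges × Direction))

module Game (B : Board) where
  open Board B

  Vertex Edge Arrow : Set
  Vertex = Fin #vertices
  Edge   = Fin #edges
  Arrow  = Edge × Direction

  source target : Arrow → Vertex
  source (e , forward)  = end₁ e
  source (e , backward) = end₂ e
  target (e , forward)  = end₂ e
  target (e , backward) = end₁ e

  reverse : Arrow → Arrow
  reverse (e , d) = e , opposite d

  Incident : Edge → Vertex → Set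
  Incident e v = end₁ e ≡ v ⊎ end₂ e ≡ v

  -- `nothing` is an unmarked edge.
  Position : Set
  Position = Vec (Maybe Direction) #edges

  empty : Position
  empty = replicate #edges nothing

  Unmarked : Position → Edge → Set
  Unmarked p e = lookup p e ≡ nothing

  Marked : Position → Arrow → Set
  Marked p (e , d) = lookup p e ≡ just d

  mark : Position → Arrow → Position
  mark p (e , d) = p [ e ]≔ just d

  IsSink IsSource : Position → Vertex → Set
  IsSink   p v = ∀ e → Incident e v → ∃ λ d → Marked p (e , d) × target (e , d) ≡ v
  IsSource p v = ∀ e → Incident e v → ∃ λ d → Marked p (e , d) × source (e , d) ≡ v

  Creates : (Position → Vertex → Set) → Position → Arrow → Set
  Creates P p a = ∃ λ v → ¬ P p v × P (mark p a) v

  record Legal (p : Position) (a : Arrow) : Set where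
    field
      unmarked : let (e , _) = a in Unmarked p e
      noSink   : ¬ Creates IsSink p a
      noSource : ¬ Creates IsSource p a

  IsCycleCell : Position → List Arrow → Set
  IsCycleCell p c = All (Marked p) c ⊎ All (Marked p ∘ reverse) c

  HasCycleCell : Position → Set
  HasCycleCell p = Any (IsCycleCell p) cells

  data Player : Set where
    player1 player2 : Player

  opponent : Player → Player
  opponent player1 = player2
  opponent player2 = player1

  -- `Inevitable w m p`: from position p with player m to move, every line of
  -- legal play comes to an end and is won by w.  Play stops as soon as there
  -- is a cycle cell, so in `cycleCell` it was the preceding move, made by the
  -- opponent of m, that created it; in `noMoves` the last move was likewise
  -- made by the opponent of m.
  data Inevitable (w : Player) : Player → Position → Set where
    cycleCell : ∀ {m p} → HasCycleCell p → w ≡ opponent m → Inevitable w m p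
    noMoves   : ∀ {m p} → ¬ HasCycleCell p → (∀ a → ¬ Legal p a) →
                w ≡ opponent m → Inevitable w m p
    ongoing   : ∀ {m p} → ¬ HasCycleCell p → ∃ (Legal p) →
                (∀ a → Legal p a → Inevitable w (opponent m) (mark p a)) →
                Inevitable w m p

  WinsRegardless : Player → Set
  WinsRegardless w = Inevitable w player1 empty

-- Edge i joins vertices i and i + 1 (mod n); the boundary of the only bounded
-- cell runs along the edges 0, 1, …, n - 1 in this order.  This is the cycle
-- graph only for n ≥ 3.
C : ℕ → Board
C n = record
  { #vertices = n
  ; #edges    = n
  ; end₁      = λ i → i
  ; end₂      = λ i → _mod_ (suc (toℕ i)) n {{nonZeroIndex i}}
  ; cells     = map (_, forward) (allFin n) ∷ []
  }

{-# OPTIONS --safe #-}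

-- In a position without sinks and sources no two adjacent arrows point in
-- opposite directions.  When play is over, each unmarked edge (if any) lies
-- between a forward and a backward arrow, so the unmarked edges are exactly the
-- places where the orientation changes along the cycle, and there is an even
-- number of them.  Hence the number of moves played has the parity of n.

module Submission where

open import Data.Fin using (Fin; zero; suc; toℕ; fromℕ; inject₁)
open import Data.Fin.Permutation using (Permutation′; permutation)
open import Data.Fin.Properties as Fin using (toℕ-fromℕ; toℕ-fromℕ<; toℕ-inject₁; toℕ-injective; toℕ<n)
open import Data.Fin.Relation.Unary.Top using (view; ‵fromℕ; ‵inject₁)
open import Data.List.Membership.Propositional.Properties using (∈-allFin)
open import Data.List.Relation.Unary.All as All using ()
open import Data.List.Relation.Unary.All.Properties using (map⁻)
open import Data.List.Relation.Unary.Any as Any using (here)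
open import Data.Maybe using (Maybe; just; nothing)
open import Data.Maybe.Properties using (≡-dec)
open import Data.Nat using (ℕ; zero; suc; pred; _+_; _*_; _≤_; s≤s)
open import Data.Nat.DivMod using (_%_; _divMod_; n%n≡0; m<n⇒m%n≡m)
open import Data.Nat.Divisibility using (_∣_; divides)
open import Data.Nat.Properties using (+-0-commutativeMonoid; +-cancelʳ-≡; 1+n≢n)
open import Data.Nat.Tactic.RingSolver using (solve-∀)
open import Data.Product using (_×_; _,_; ∃; proj₁; proj₂)
open import Data.Sum using (_⊎_; inj₁; inj₂)
open import Data.Vec using (Vec; _∷_; lookup; replicate; _[_]≔_)
open import Data.Vec.Properties using (lookup∘update; lookup∘update′; lookup-replicate)
open import Function using (_∘_)
open import Relation.Binary using (DecidableEquality)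
open import Relation.Binary.PropositionalEquality
open import Relation.Nullary using (¬_; Dec; yes; no; contradiction; ¬?)
open import Relation.Nullary.Decidable using (map′; _×-dec_; _⊎-dec_; _→-dec_; decidable-stable)
open import Relation.Unary using (Decidable)
open import Defs

open import Algebra.Properties.CommutativeMonoid.Sum +-0-commutativeMonoid
  using (sum; sum-cong-≗; sum-permute; ∑-distrib-+)

-- Directions, and counting unmarked edges.

_≟ᴰ_ : DecidableEquality Direction
forward  ≟ᴰ forward  = yes refl
forward  ≟ᴰ backward = no λ ()
backward ≟ᴰ forward  = no λ ()
backward ≟ᴰ backward = yes refl

anyDirection? : ∀ {P : Direction → Set} → Decidable P → Dec (∃ P)
anyDirection? P? = map′
  (λ { (inj₁ x) → forward , x ; (inj₂ x) → backward , x })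
  (λ { (forward , x) → inj₁ x ; (backward , x) → inj₂ x })
  (P? forward ⊎-dec P? backward)

-- Indicators valued in `ℕ`, so that products express conjunctions and sums over edges express
-- counts.
unmarkedness forwardness : Maybe Direction → ℕ
unmarkedness nothing  = 1
unmarkedness (just _) = 0
forwardness (just forward) = 1
forwardness _              = 0

#unmarked : ∀ {n} → Vec (Maybe Direction) n → ℕ
#unmarked p = sum (λ i → unmarkedness (lookup p i))

#unmarked-mark : ∀ {n} (p : Vec (Maybe Direction) n) e {d} → lookup p e ≡ nothing →
                 #unmarked p ≡ suc (#unmarked (p [ e ]≔ just d))
#unmarked-mark (nothing ∷ p) zero    refl = refl
#unmarked-mark (just _ ∷ p)  (suc e) eq   = #unmarked-mark p e eq
#unmarked-mark (nothing ∷ p) (suc e) eq   = cong suc (#unmarked-mark p e eq)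

#unmarked-empty : ∀ n → #unmarked (replicate n nothing) ≡ n
#unmarked-empty zero    = refl
#unmarked-empty (suc n) = cong suc (#unmarked-empty n)

-- Arbitrary boards: decidability of the rules, and the winner from a parity condition.

module AnyBoard (B : Board) where
  open Board B
  open Game B

  Marked? : ∀ p a → Dec (Marked p a)
  Marked? p (e , d) = ≡-dec _≟ᴰ_ (lookup p e) (just d)

  allAt? : ∀ {P : Edge → Set} v → Decidable P → Dec (∀ e → Incident e v → P e)
  allAt? v P? = Fin.all? λ e → (end₁ e Fin.≟ v ⊎-dec end₂ e Fin.≟ v) →-dec P? e

  IsSink? : ∀ p v → Dec (IsSink p v)
  IsSink? p v = allAt? v λ e → anyDirection? λ d → Marked? p (e , d) ×-dec target (e , d) Fin.≟ v

  IsSource? : ∀ p v → Dec (IsSource p v)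
  IsSource? p v = allAt? v λ e → anyDirection? λ d → Marked? p (e , d) ×-dec source (e , d) Fin.≟ v

  Creates? : ∀ {P : Position → Vertex → Set} → (∀ p v → Dec (P p v)) → ∀ p a → Dec (Creates P p a)
  Creates? P? p a = Fin.any? λ v → ¬? (P? p v) ×-dec P? (mark p a) v

  Legal? : ∀ p a → Dec (Legal p a)
  Legal? p a@(e , _) = map′
    (λ (u , k , r) → record { unmarked = u ; noSink = k ; noSource = r })
    (λ l → Legal.unmarked l , Legal.noSink l , Legal.noSource l)
    (≡-dec _≟ᴰ_ (lookup p e) nothing
      ×-dec ¬? (Creates? IsSink? p a) ×-dec ¬? (Creates? IsSource? p a))

  anyLegal? : ∀ p → Dec (∃ (Legal p))
  anyLegal? p = map′
    (λ (e , d , l) → (e , d) , l)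
    (λ ((e , d) , l) → e , d , l)
    (Fin.any? λ e → anyDirection? λ d → Legal? p (e , d))

  HasCycleCell? : ∀ p → Dec (HasCycleCell p)
  HasCycleCell? p = Any.any?
    (λ c → All.all? (Marked? p) c ⊎-dec All.all? (Marked? p ∘ reverse) c) cells

  -- The invariant of play: the rules only forbid creating sinks and sources, so their absence has
  -- to be carried along from the start.
  Admissible : Position → Set
  Admissible p = ∀ v → ¬ IsSink p v × ¬ IsSource p v

  Admissible-mark : ∀ {p a} → Admissible p → Legal p a → Admissible (mark p a)
  Admissible-mark adm l v =
    (λ s → Legal.noSink l (v , proj₁ (adm v) , s)) ,
    (λ s → Legal.noSource l (v , proj₂ (adm v) , s))

  moverAfter : ℕ → Player → Player
  moverAfter zero    m = m
  moverAfter (suc k) m = moverAfter k (opponent m)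

  moverAfter-even : ∀ q m → moverAfter (q * 2) m ≡ m
  moverAfter-even zero    m       = refl
  moverAfter-even (suc q) player1 = moverAfter-even q player1
  moverAfter-even (suc q) player2 = moverAfter-even q player2

  IsOver : Position → Set
  IsOver p = HasCycleCell p ⊎ (∀ a → ¬ Legal p a)

  -- If an even number of edges stays unmarked, the last mover is the one that
  -- would have marked the last edge had all edges been marked.
  inevitable : (∀ p → Admissible p → IsOver p → 2 ∣ #unmarked p) →
               ∀ k {p} m → #unmarked p ≡ k → Admissible p →
               Inevitable (opponent (moverAfter k m)) m p
  inevitable even k {p} m eq adm = go k eq (HasCycleCell? p) (anyLegal? p)
    where
    -- When play is over the winner is `opponent m`; an even number of turns brings the move back to
    -- `m`.
    winner : ∀ {k} → #unmarked p ≡ k → IsOver p → opponent (moverAfter k m) ≡ opponent m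
    winner eq over with even p adm over
    ... | divides q eq′ = cong opponent
      (trans (cong (λ k → moverAfter k m) (trans (sym eq) eq′)) (moverAfter-even q m))

    go : ∀ k → #unmarked p ≡ k → Dec (HasCycleCell p) → Dec (∃ (Legal p)) →
         Inevitable (opponent (moverAfter k m)) m p
    go k eq (yes c) _ = cycleCell c (winner eq (inj₁ c))
    go k eq (no ¬c) (no ¬l) = noMoves ¬c ¬l′ (winner eq (inj₂ ¬l′))
      where ¬l′ = λ a l → ¬l (a , l)
    go zero eq (no _) (yes ((e , _) , l))
      with () ← trans (sym eq) (#unmarked-mark p e {forward} (Legal.unmarked l))
    -- `moverAfter (suc k) m` unfolds to `moverAfter k (opponent m)`, so the predicted winner is the
    -- same before and after the move.
    go (suc k) eq (no ¬c) (yes l) = ongoing ¬c l λ a@(e , _) la →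
      inevitable even k (opponent m)
        (cong pred (trans (sym (#unmarked-mark p e (Legal.unmarked la))) eq))
        (Admissible-mark adm la)

-- The cycle board: rotation of the edges, clashing neighbours, blocked edges.

module Cycle (k : ℕ) where
  n : ℕ
  n = suc (suc k)
  open Board (C n) using () renaming (end₂ to next)
  open Game (C n)
  open AnyBoard (C n)

  next-inject₁ : ∀ i → next (inject₁ i) ≡ suc i
  next-inject₁ i = toℕ-injective (begin
    toℕ (next (inject₁ i))      ≡⟨ toℕ-fromℕ< _ ⟩
    suc (toℕ (inject₁ i)) % n   ≡⟨ cong (λ j → suc j % n) (toℕ-inject₁ i) ⟩
    suc (toℕ i) % n             ≡⟨ m<n⇒m%n≡m (s≤s (toℕ<n i)) ⟩
    suc (toℕ i)                 ∎)
    where open ≡-Reasoning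

  next-fromℕ : next (fromℕ (suc k)) ≡ zero
  next-fromℕ = toℕ-injective (begin
    toℕ (next (fromℕ (suc k)))      ≡⟨ toℕ-fromℕ< _ ⟩
    suc (toℕ (fromℕ (suc k))) % n   ≡⟨ cong (λ j → suc j % n) (toℕ-fromℕ (suc k)) ⟩
    n % n                           ≡⟨ n%n≡0 n ⟩
    0                               ∎)
    where open ≡-Reasoning

  -- Vertices and edges are both `Fin n`: the edges at vertex `v` are `prev v`, which ends there,
  -- and `v`, which starts there. Likewise `next e` is both the second end of `e` and the edge after
  -- it.
  prev : Edge → Edge
  prev zero    = fromℕ (suc k)
  prev (suc i) = inject₁ i

  next-prev : ∀ i → next (prev i) ≡ i
  next-prev zero    = next-fromℕ
  next-prev (suc i) = next-inject₁ i

  prev-next : ∀ i → prev (next i) ≡ i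
  prev-next i with view i
  ... | ‵fromℕ     = cong prev next-fromℕ
  ... | ‵inject₁ j = cong prev (next-inject₁ j)

  next-injective : ∀ {i j} → next i ≡ next j → i ≡ j
  next-injective {i} {j} eq = trans (sym (prev-next i)) (trans (cong prev eq) (prev-next j))

  next≢ : ∀ i → next i ≢ i
  next≢ i eq with view i
  -- The last edge has index `suc k`, hence is not `zero`.
  ... | ‵fromℕ with () ← trans (sym next-fromℕ) eq
  ... | ‵inject₁ j = 1+n≢n (trans (cong toℕ (trans (sym (next-inject₁ j)) eq)) (toℕ-inject₁ j))

  rotation : Permutation′ n
  rotation = permutation next prev next-prev prev-next

  -- For `forward` both arrows at `v` point towards it, for `backward` both point away: sinks and
  -- sources in one notion.
  Clash : Direction → Position → Vertex → Set
  Clash d p v = Marked p (prev v , d) × Marked p (v , opposite d)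

  -- Either edge at `v`, if marked the other way, would have `v` as both of its ends, against
  -- `next≢`.
  sink⇒clash : ∀ p {v} → IsSink p v → Clash forward p v
  sink⇒clash p {v} s = into (s (prev v) (inj₂ (next-prev v))) , out (s v (inj₁ refl))
    where
    into : (∃ λ d → Marked p (prev v , d) × target (prev v , d) ≡ v) → Marked p (prev v , forward)
    into (forward  , m , _) = m
    into (backward , _ , t) = contradiction (trans (next-prev v) (sym t)) (next≢ (prev v))
    out : (∃ λ d → Marked p (v , d) × target (v , d) ≡ v) → Marked p (v , backward)
    out (forward  , _ , t) = contradiction t (next≢ v)
    out (backward , m , _) = m

  source⇒clash : ∀ p {v} → IsSource p v → Clash backward p v
  source⇒clash p {v} s = into (s (prev v) (inj₂ (next-prev v))) , out (s v (inj₁ refl))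
    where
    into : (∃ λ d → Marked p (prev v , d) × source (prev v , d) ≡ v) → Marked p (prev v , backward)
    into (backward , m , _) = m
    into (forward  , _ , t) = contradiction (trans (next-prev v) (sym t)) (next≢ (prev v))
    out : (∃ λ d → Marked p (v , d) × source (v , d) ≡ v) → Marked p (v , forward)
    out (backward , _ , t) = contradiction t (next≢ v)
    out (forward  , m , _) = m

  clash⇒sink : ∀ p {v} → Clash forward p v → IsSink p v
  clash⇒sink p (_ , m) e (inj₁ refl) = backward , m , refl
  clash⇒sink p (m , _) e (inj₂ refl) =
    forward , subst (λ i → Marked p (i , forward)) (prev-next e) m , refl

  clash⇒source : ∀ p {v} → Clash backward p v → IsSource p v
  clash⇒source p (_ , m) e (inj₁ refl) = forward , m , refl
  clash⇒source p (m , _) e (inj₂ refl) =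
    backward , subst (λ i → Marked p (i , backward)) (prev-next e) m , refl

  -- The two alternatives are the clashes that the arrow would cause at the vertices `e` and
  -- `next e`.
  Blocked : Position → Arrow → Set
  Blocked p (e , d) = Marked p (prev e , opposite d) ⊎ Marked p (next e , opposite d)

  opposite-involutive : ∀ d → opposite (opposite d) ≡ d
  opposite-involutive forward  = refl
  opposite-involutive backward = refl

  Marked-mark-≡ : ∀ p e {d c} → Marked (mark p (e , d)) (e , c) → d ≡ c
  Marked-mark-≡ p e m with refl ← trans (sym (lookup∘update e p _)) m = refl

  Marked-mark-≢ : ∀ p {e i d c} → i ≢ e → Marked (mark p (e , d)) (i , c) → Marked p (i , c)
  Marked-mark-≢ p i≢e m = trans (sym (lookup∘update′ i≢e p _)) m

  -- A new clash must involve the new arrow; the other arrow of the clash was there before and is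
  -- the one that blocks.
  newClash⇒blocked : ∀ p {e d c v} → ¬ Clash c p v → Clash c (mark p (e , d)) v → Blocked p (e , d)
  newClash⇒blocked p {e} {d} {c} {v} ¬clash (m₁ , m₂) with v Fin.≟ e | prev v Fin.≟ e
  ... | yes refl | yes eq = contradiction (trans (next-prev v) (sym eq)) (next≢ (prev v))
  ... | yes refl | no ≢e with refl ← Marked-mark-≡ p e m₂ =
    inj₁ (subst (λ x → Marked p (prev e , x)) (sym (opposite-involutive c)) (Marked-mark-≢ p ≢e m₁))
  ... | no ≢e | yes refl with refl ← Marked-mark-≡ p e m₁ =
    inj₂ (subst (λ i → Marked p (i , opposite c)) (sym (next-prev v)) (Marked-mark-≢ p ≢e m₂))
  ... | no ≢e | no ≢e′ = contradiction (Marked-mark-≢ p ≢e′ m₁ , Marked-mark-≢ p ≢e m₂) ¬clash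

  -- An arrow that is not blocked creates no clash, hence neither a sink nor a source; decidability
  -- removes the double negation.
  illegal⇒blocked : ∀ p {e} d → Unmarked p e → ¬ Legal p (e , d) → Blocked p (e , d)
  illegal⇒blocked p {e} d u ¬l = decidable-stable
    (Marked? p (prev e , opposite d) ⊎-dec Marked? p (next e , opposite d))
    λ ¬b → ¬l record
      { unmarked = u
      ; noSink   = λ (v , ¬s , s) → ¬b (newClash⇒blocked p (¬s ∘ clash⇒sink p) (sink⇒clash (mark p (e , d)) s))
      ; noSource = λ (v , ¬s , s) → ¬b (newClash⇒blocked p (¬s ∘ clash⇒source p) (source⇒clash (mark p (e , d)) s))
      }

  cycleCell⇒marked : ∀ p → HasCycleCell p → ∀ e → ∃ λ d → Marked p (e , d)
  cycleCell⇒marked p (here (inj₁ ms)) e = forward  , All.lookup (map⁻ ms) (∈-allFin e)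
  cycleCell⇒marked p (here (inj₂ ms)) e = backward , All.lookup (map⁻ ms) (∈-allFin e)

  -- A cycle cell leaves no edge unmarked, since its boundary is the whole cycle; otherwise neither
  -- direction is legal at `e`.
  over⇒blocked : ∀ p {e} → IsOver p → Unmarked p e → ∀ d → Blocked p (e , d)
  over⇒blocked p {e} (inj₁ c) u d
    with () ← trans (sym u) (proj₂ (cycleCell⇒marked p c e))
  over⇒blocked p (inj₂ ¬l) u d = illegal⇒blocked p d u (¬l _)

  Admissible-empty : Admissible empty
  Admissible-empty v =
    (λ s → unmarked (proj₂ (sink⇒clash empty s))) , (λ s → unmarked (proj₂ (source⇒clash empty s)))
    where
    unmarked : ∀ {d} → ¬ Marked empty (v , d)
    unmarked m with () ← trans (sym (lookup-replicate v nothing)) m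

  -- Parity of the number of unmarked edges once play is over.

  module _ (p : Position) (adm : Admissible p) (over : IsOver p) where

    -- Along the cycle, `UF` detects an unmarked edge followed by a forward arrow, and `FU` a
    -- forward arrow followed by an unmarked edge; both are indexed by the unmarked edge.
    U F UF FU : Edge → ℕ
    U e  = unmarkedness (lookup p e)
    F e  = forwardness (lookup p e)
    UF e = U e * F (next e)
    FU e = U e * F (prev e)

    -- Being blocked in both directions, an unmarked edge has a backward and a forward neighbour, so
    -- exactly one of its neighbours is forward.
    unmarked-split : ∀ e → U e ≡ UF e + FU e
    unmarked-split e with lookup p e in eq
    ... | just _  = refl
    ... | nothing with over⇒blocked p over eq forward | over⇒blocked p over eq backward
    ... | inj₁ b | inj₁ f with () ← trans (sym b) f
    ... | inj₁ b | inj₂ f rewrite b | f = refl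
    ... | inj₂ b | inj₁ f rewrite b | f = refl
    ... | inj₂ b | inj₂ f with () ← trans (sym b) f

    -- Both sides equal 1 if one of the two edges is forward, and 0 otherwise.
    transition : ∀ e → UF e + F e ≡ U (next e) * F e + F (next e)
    transition e with lookup p e in eq | lookup p (next e) in eq′
    ... | nothing       | nothing       = refl
    ... | nothing       | just forward  = refl
    ... | nothing       | just backward = refl
    ... | just forward  | nothing       = refl
    ... | just backward | nothing       = refl
    ... | just forward  | just forward  = refl
    ... | just backward | just backward = refl
    -- Here the common vertex `next e` would be a sink, and in the last case a source.
    ... | just forward  | just backward = contradiction
      (clash⇒sink p (subst (λ i → Marked p (i , forward)) (sym (prev-next e)) eq , eq′))
      (proj₁ (adm (next e)))
    ... | just backward | just forward  = contradiction
      (clash⇒source p (subst (λ i → Marked p (i , backward)) (sym (prev-next e)) eq , eq′))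
      (proj₂ (adm (next e)))

    -- Runs of forward arrows begin as often as they end. Summing `transition` around the cycle, `F`
    -- and `F ∘ next` have equal sums and cancel; rotating the index turns the remaining sum into
    -- that of `FU`.
    ΣUF≡ΣFU : sum UF ≡ sum FU
    ΣUF≡ΣFU = +-cancelʳ-≡ (sum F) _ _ (begin
      sum UF + sum F                                  ≡⟨ ∑-distrib-+ UF F ⟨
      sum (λ e → UF e + F e)                          ≡⟨ sum-cong-≗ transition ⟩
      sum (λ e → U (next e) * F e + F (next e))       ≡⟨ ∑-distrib-+ (λ e → U (next e) * F e) (F ∘ next) ⟩
      sum (λ e → U (next e) * F e) + sum (F ∘ next)   ≡⟨ cong₂ _+_ rotate (sum-permute F rotation) ⟨
      sum FU + sum F                                  ∎)
      where
      open ≡-Reasoning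
      rotate : sum FU ≡ sum (λ e → U (next e) * F e)
      rotate = trans (sum-permute FU rotation)
        (sum-cong-≗ λ e → cong (λ i → U (next e) * F i) (prev-next e))

    over⇒even : 2 ∣ #unmarked p
    over⇒even = divides (sum UF) (begin
      #unmarked p              ≡⟨ sum-cong-≗ unmarked-split ⟩
      sum (λ e → UF e + FU e)  ≡⟨ ∑-distrib-+ UF FU ⟩
      sum UF + sum FU          ≡⟨ cong (sum UF +_) ΣUF≡ΣFU ⟨
      sum UF + sum UF          ≡⟨ double (sum UF) ⟩
      sum UF * 2               ∎)
      where
      open ≡-Reasoning
      double : ∀ a → a + a ≡ a * 2
      double = solve-∀

  -- The winner by the parity of `n`.

  outcome : WinsRegardless (opponent (moverAfter n player1))
  outcome = inevitable over⇒even n player1 (#unmarked-empty n) Admissible-empty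

  even⇒player2 : 2 ∣ n → WinsRegardless player2
  even⇒player2 (divides q eq) = subst WinsRegardless
    (cong opponent (trans (cong (λ j → moverAfter j player1) eq) (moverAfter-even q player1))) outcome

  odd⇒player1 : ¬ (2 ∣ n) → WinsRegardless player1
  odd⇒player1 ¬2∣n with n divMod 2
  ... | record { quotient = q ; remainder = zero ; property = eq } = contradiction (divides q eq) ¬2∣n
  -- The odd turn passes the move from `player1` to `player2` and the remaining `q * 2` turns change
  -- nothing, so the winner is the opponent of `player2`.
  ... | record { quotient = q ; remainder = suc zero ; property = eq } = subst WinsRegardless
    (cong opponent (trans (cong (λ j → moverAfter j player1) eq) (moverAfter-even q player2))) outcome

theorem4p3 : (n : ℕ) → 3 ≤ n → (¬ (2 ∣ n) → Game.WinsRegardless (C n) Game.player1) × (2 ∣ n → Game.WinsRegardless (C n) Game.player2)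
-- `Cycle` treats the cycle whose length is its parameter plus 2, hence the argument `suc k`.
theorem4p3 (suc (suc (suc k))) (s≤s (s≤s (s≤s _))) = Cycle.odd⇒player1 (suc k) , Cycle.even⇒player2 (suc k)
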